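{- Let $n\geq 4$, let $S$ be the set of all $3$-cycles in $S_n$, and let $CAG_n=\mathrm{Cay}(A_n,S)$. Then $$\mathrm{Aut}(CAG_n)\supseteq (R(A_n)\rtimes \mathrm{Inn}(S_n))\rtimes \mathbb{Z}_2\cong (A_n\rtimes S_n)\rtimes \mathbb{Z}_2,$$ where $R(A_n)$ is the right regular representation of $A_n$, $\mathrm{Inn}(S_n)$ is the inner automorphism group of $S_n$ (acting on $A_n$ by conjugation), and $\mathbb{Z}_2=\langle h\rangle$ with $h$ the map $\alpha\mapsto\alpha^{ -1}$ for all $\alpha\in A_n$.
   Context: For a finite group $\Gamma$ and a subset $T\subseteq\Gamma$ with $e\notin T$ and $T=T^{ -1}$, the Cayley graph $\mathrm{Cay}(\Gamma,T)$ is the undirected graph with vertex set $\Gamma$ and edge set $\{\{\gamma,t\gamma\}\mid \gamma\in\Gamma, t\in T\}$. The right regular representation is $R(\Gamma)=\{r_\gamma: x\mapsto x\gamma\mid\gamma\in\Gamma\}$. -}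

module Defs where

open import Algebra.Bundles using (Group)
open import Algebra.Morphism.Structures using (IsGroupIsomorphism)
import Algebra.Properties.Group as GroupProperties
open import Data.Fin.Base using (Fin)
open import Data.Fin.Permutation using (Permutation′; _⟨$⟩ʳ_; transpose; inverseˡ; inverseʳ)
import Data.Fin.Permutation.Components as PC
open import Data.Fin.Permutation.Transposition.List using (TranspositionList; eval)
open import Data.Fin.Properties using (_≟_)
open import Data.List.Base using ([]; _∷_; _++_; length; map)
open import Data.List.Properties using (length-++; length-map)
open import Data.List.Relation.Unary.All using (All; []; _∷_)
open import Data.List.Relation.Unary.All.Properties using (++⁺)
open import Data.Nat.Base using (ℕ; suc)
open import Data.Nat.Divisibility using (_∣_; divides; ∣m∣n⇒∣m+n)
open import Data.Nat.Properties using (+-comm)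
open import Data.Parity.Base using (Parity; 0ℙ; 1ℙ)
import Data.Parity.Properties as ℙ
open import Data.Product.Base using (∃; ∃-syntax; Σ; _×_; _,_; proj₁; proj₂)
open import Function.Bundles using (Inverse; Equivalence; _⇔_; mk⇔)
import Function.Properties.Inverse as Inv
open import Level using (Level; 0ℓ; _⊔_) renaming (suc to lsuc)
open import Relation.Binary.Bundles using (Setoid)
open import Relation.Binary.Core using (Rel)
open import Relation.Binary.Definitions using (Symmetric; _Respects_; _Respects₂_)
open import Relation.Binary.PropositionalEquality as ≡ using (_≡_; _≢_)
import Relation.Binary.Reasoning.Setoid as SetoidReasoning
open import Relation.Nullary.Decidable using (yes; no)
open import Relation.Nullary.Negation using (¬_; contradiction)
open import Relation.Unary using (Pred; _∈_; _⊆_)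

private
  variable
    c ℓ c₁ ℓ₁ c₂ ℓ₂ p q : Level

_≅_ : Group c₁ ℓ₁ → Group c₂ ℓ₂ → Set (c₁ ⊔ ℓ₁ ⊔ c₂ ⊔ ℓ₂)
G ≅ H = ∃ (IsGroupIsomorphism (Group.rawGroup G) (Group.rawGroup H))

record Subgroup (G : Group c ℓ) (p : Level) : Set (c ⊔ ℓ ⊔ lsuc p) where
  open Group G
  field
    Mem       : Pred Carrier p
    resp      : Mem Respects _≈_
    ε-closed  : ε ∈ Mem
    ∙-closed  : ∀ {x y} → x ∈ Mem → y ∈ Mem → (x ∙ y) ∈ Mem
    ⁻¹-closed : ∀ {x} → x ∈ Mem → (x ⁻¹) ∈ Mem

open Subgroup public

asGroup : {G : Group c ℓ} → Subgroup G p → Group (c ⊔ p) ℓ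
asGroup {G = G} H = record
  { Carrier = Σ Carrier (Mem H)
  ; _≈_     = λ x y → proj₁ x ≈ proj₁ y
  ; _∙_     = λ (x , x∈H) (y , y∈H) → x ∙ y , ∙-closed H x∈H y∈H
  ; ε       = ε , ε-closed H
  ; _⁻¹     = λ (x , x∈H) → x ⁻¹ , ⁻¹-closed H x∈H
  ; isGroup = record
    { isMonoid = record
      { isSemigroup = record
        { isMagma = record
          { isEquivalence = record { refl = refl ; sym = sym ; trans = trans }
          ; ∙-cong        = ∙-cong
          }
        ; assoc = λ x y z → assoc (proj₁ x) (proj₁ y) (proj₁ z)
        }
      ; identity = (λ x → identityˡ (proj₁ x)) , (λ x → identityʳ (proj₁ x))
      }
    ; inverse = (λ x → inverseˡ′ (proj₁ x)) , (λ x → inverseʳ′ (proj₁ x))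
    ; ⁻¹-cong = ⁻¹-cong
    }
  }
  where open Group G renaming (inverseˡ to inverseˡ′; inverseʳ to inverseʳ′)

module _ (G : Group c ℓ) where
  open Group G

  conj : Carrier → Carrier → Carrier
  conj g x = g ∙ x ∙ g ⁻¹

  IsNormal : Subgroup G p → Set (c ⊔ p)
  IsNormal N = ∀ g {x} → x ∈ Mem N → conj g x ∈ Mem N

  data Generated (g : Carrier) : Pred Carrier (c ⊔ ℓ) where
    gen  : g ∈ Generated g
    unit : ε ∈ Generated g
    mul  : ∀ {x y} → x ∈ Generated g → y ∈ Generated g → (x ∙ y) ∈ Generated g
    inv  : ∀ {x} → x ∈ Generated g → (x ⁻¹) ∈ Generated g
    eq   : ∀ {x y} → x ≈ y → x ∈ Generated g → y ∈ Generated g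

  ⟨_⟩ : Carrier → Subgroup G (c ⊔ ℓ)
  ⟨ g ⟩ = record
    { Mem = Generated g ; resp = eq ; ε-closed = unit ; ∙-closed = mul ; ⁻¹-closed = inv }

  module _ {p q r : Level} where

    -- K is the internal semidirect product N ⋊ H of subgroups N and H of G.
    record IsInternalSemidirect (N : Subgroup G p) (H : Subgroup G q) (K : Subgroup G r) :
                                Set (c ⊔ ℓ ⊔ p ⊔ q ⊔ r) where
      field
        N⊆K     : Mem N ⊆ Mem K
        H⊆K     : Mem H ⊆ Mem K
        normal  : ∀ {k x} → k ∈ Mem K → x ∈ Mem N → conj k x ∈ Mem N
        trivial : ∀ {x} → x ∈ Mem N → x ∈ Mem H → x ≈ ε
        K⊆NH    : ∀ {k} → k ∈ Mem K → ∃[ x ] ∃[ y ] (x ∈ Mem N × y ∈ Mem H × k ≈ x ∙ y)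

module ConjProperties (G : Group c ℓ) where
  open Group G
  open GroupProperties G
  open SetoidReasoning setoid

  conj-cong : ∀ {g h x y} → g ≈ h → x ≈ y → conj G g x ≈ conj G h y
  conj-cong g≈h x≈y = ∙-cong (∙-cong g≈h x≈y) (⁻¹-cong g≈h)

  cancel-mid : ∀ a b d → (a ∙ b ⁻¹) ∙ (b ∙ d) ≈ a ∙ d
  cancel-mid a b d = begin
    (a ∙ b ⁻¹) ∙ (b ∙ d)  ≈⟨ assoc a (b ⁻¹) (b ∙ d) ⟩
    a ∙ (b ⁻¹ ∙ (b ∙ d))  ≈⟨ ∙-congˡ (\\-leftDividesʳ b d) ⟩
    a ∙ d                 ∎

  conj-∙ : ∀ g x y → conj G g (x ∙ y) ≈ conj G g x ∙ conj G g y
  conj-∙ g x y = sym (begin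
    (g ∙ x ∙ g ⁻¹) ∙ (g ∙ y ∙ g ⁻¹)    ≈⟨ ∙-congˡ (assoc g y (g ⁻¹)) ⟩
    (g ∙ x ∙ g ⁻¹) ∙ (g ∙ (y ∙ g ⁻¹))  ≈⟨ cancel-mid (g ∙ x) g (y ∙ g ⁻¹) ⟩
    (g ∙ x) ∙ (y ∙ g ⁻¹)               ≈⟨ assoc (g ∙ x) y (g ⁻¹) ⟨
    (g ∙ x) ∙ y ∙ g ⁻¹                 ≈⟨ ∙-congʳ (assoc g x y) ⟩
    g ∙ (x ∙ y) ∙ g ⁻¹                 ∎)

  conj-comp : ∀ g h x → conj G (g ∙ h) x ≈ conj G g (conj G h x)
  conj-comp g h x = begin
    (g ∙ h) ∙ x ∙ (g ∙ h) ⁻¹         ≈⟨ ∙-cong (assoc g h x) (⁻¹-anti-homo-∙ g h) ⟩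
    g ∙ (h ∙ x) ∙ (h ⁻¹ ∙ g ⁻¹)      ≈⟨ assoc (g ∙ (h ∙ x)) (h ⁻¹) (g ⁻¹) ⟨
    g ∙ (h ∙ x) ∙ h ⁻¹ ∙ g ⁻¹        ≈⟨ ∙-congʳ (assoc g (h ∙ x) (h ⁻¹)) ⟩
    g ∙ (h ∙ x ∙ h ⁻¹) ∙ g ⁻¹        ∎

  conj-ε : ∀ x → conj G ε x ≈ x
  conj-ε x = begin
    ε ∙ x ∙ ε ⁻¹  ≈⟨ ∙-cong (identityˡ x) ε⁻¹≈ε ⟩
    x ∙ ε         ≈⟨ identityʳ x ⟩
    x             ∎

  conj-inverse : ∀ g x → conj G (g ⁻¹) (conj G g x) ≈ x
  conj-inverse g x = begin
    conj G (g ⁻¹) (conj G g x)  ≈⟨ conj-comp (g ⁻¹) g x ⟨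
    conj G (g ⁻¹ ∙ g) x         ≈⟨ conj-cong (inverseˡ′ g) refl ⟩
    conj G ε x                  ≈⟨ conj-ε x ⟩
    x                           ∎
    where open Group G using () renaming (inverseˡ to inverseˡ′)

  conj-⁻¹ : ∀ g x → conj G g (x ⁻¹) ≈ conj G g x ⁻¹
  conj-⁻¹ g x = inverseˡ-unique _ _ (begin
    conj G g (x ⁻¹) ∙ conj G g x  ≈⟨ conj-∙ g (x ⁻¹) x ⟨
    conj G g (x ⁻¹ ∙ x)           ≈⟨ conj-cong refl (inverseˡ′ x) ⟩
    g ∙ ε ∙ g ⁻¹                  ≈⟨ ∙-congʳ (identityʳ g) ⟩
    g ∙ g ⁻¹                      ≈⟨ inverseʳ′ g ⟩
    ε                             ∎)
    where open Group G using () renaming (inverseˡ to inverseˡ′; inverseʳ to inverseʳ′)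

-- The product f ∙ g applies g first.
Sym : Setoid c ℓ → Group (c ⊔ ℓ) (c ⊔ ℓ)
Sym X = record
  { Carrier = Inverse X X
  ; _≈_     = λ f g → ∀ x → to f x ≈ to g x
  ; _∙_     = λ f g → Inv.trans g f
  ; ε       = Inv.refl X
  ; _⁻¹     = Inv.sym
  ; isGroup = record
    { isMonoid = record
      { isSemigroup = record
        { isMagma = record
          { isEquivalence = record
            { refl  = λ x → refl
            ; sym   = λ f≈g x → sym (f≈g x)
            ; trans = λ f≈g g≈h x → trans (f≈g x) (g≈h x)
            }
          ; ∙-cong = λ {f} {f′} {g} {g′} f≈f′ g≈g′ x →
              trans (to-cong f (g≈g′ x)) (f≈f′ (to g′ x))
          }
        ; assoc = λ f g h x → refl
        }
      ; identity = (λ f x → refl) , (λ f x → refl)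
      }
    ; inverse = (λ f x → strictlyInverseʳ f x) , (λ f x → strictlyInverseˡ f x)
    ; ⁻¹-cong = λ {f} {g} f≈g x → trans
        (from-cong f (trans (sym (strictlyInverseˡ g x)) (sym (f≈g (from g x)))))
        (strictlyInverseʳ f (from g x))
    }
  }
  where
  open Setoid X
  open Inverse

module _ (Γ : Group c ℓ) where
  open Group Γ renaming (inverseˡ to inverseˡ′; inverseʳ to inverseʳ′)
  open GroupProperties Γ
  open ConjProperties Γ
  open Inverse

  rightMul : Carrier → Inverse setoid setoid
  rightMul γ = record
    { to        = _∙ γ
    ; from      = _∙ γ ⁻¹
    ; to-cong   = ∙-congʳ
    ; from-cong = ∙-congʳ
    ; inverse   = (λ {x} e → trans (∙-congʳ e) (//-rightDividesˡ γ x))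
                , (λ {x} e → trans (∙-congʳ e) (//-rightDividesʳ γ x))
    }

  RightRegular : Subgroup (Sym setoid) (c ⊔ ℓ)
  RightRegular = record
    { Mem       = λ f → ∃[ γ ] (∀ x → to f x ≈ to (rightMul γ) x)
    ; resp      = λ f≈g (γ , e) → γ , λ x → trans (sym (f≈g x)) (e x)
    ; ε-closed  = ε , λ x → sym (identityʳ x)
    ; ∙-closed  = λ {f} {g} (γ , e) (δ , d) → δ ∙ γ , λ x →
        trans (to-cong f (d x)) (trans (e (x ∙ δ)) (assoc x δ γ))
    ; ⁻¹-closed = λ {f} (γ , e) → γ ⁻¹ , λ x →
        trans (sym (//-rightDividesʳ γ (from f x)))
              (∙-congʳ (trans (sym (e (from f x))) (strictlyInverseˡ f x)))
    }

  Inn : Subgroup (Sym setoid) (c ⊔ ℓ)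
  Inn = record
    { Mem       = λ f → ∃[ g ] (∀ x → to f x ≈ conj Γ g x)
    ; resp      = λ f≈f′ (g , e) → g , λ x → trans (sym (f≈f′ x)) (e x)
    ; ε-closed  = ε , λ x → sym (conj-ε x)
    ; ∙-closed  = λ {f} {f′} (g , e) (h , d) → g ∙ h , λ x →
        trans (to-cong f (d x)) (trans (e (conj Γ h x)) (sym (conj-comp g h x)))
    ; ⁻¹-closed = λ {f} (g , e) → g ⁻¹ , λ x →
        trans (sym (conj-inverse g (from f x)))
              (conj-cong refl (trans (sym (e (from f x))) (strictlyInverseˡ f x)))
    }

  inversion : Inverse setoid setoid
  inversion = record
    { to        = _⁻¹
    ; from      = _⁻¹
    ; to-cong   = ⁻¹-cong
    ; from-cong = ⁻¹-cong
    ; inverse   = (λ {x} e → trans (⁻¹-cong e) (⁻¹-involutive x))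
                , (λ {x} e → trans (⁻¹-cong e) (⁻¹-involutive x))
    }

module _ (Γ : Group c ℓ) (N : Subgroup Γ p) where
  open Group Γ
  open Inverse

  private
    𝑁 : Group (c ⊔ p) ℓ
    𝑁 = asGroup N

  Restricts : Inverse setoid setoid → Inverse (Group.setoid 𝑁) (Group.setoid 𝑁) → Set (c ⊔ ℓ ⊔ p)
  Restricts φ f = ∀ x → proj₁ (to f x) ≈ to φ (proj₁ x)

  -- The permutations of N induced by Inn(Γ).
  InnOn : Subgroup (Sym (Group.setoid 𝑁)) (c ⊔ ℓ ⊔ p)
  InnOn = record
    { Mem       = λ f → ∃[ φ ] (φ ∈ Mem (Inn Γ) × Restricts φ f)
    ; resp      = λ f≈g (φ , i , e) → φ , i , λ x → trans (sym (f≈g x)) (e x)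
    ; ε-closed  = Inv.refl setoid , ε-closed (Inn Γ) , λ x → refl
    ; ∙-closed  = λ {f} {g} (φ , i , e) (ψ , j , d) →
        Inv.trans ψ φ , ∙-closed (Inn Γ) {φ} {ψ} i j ,
        λ x → trans (e (to g x)) (to-cong φ (d x))
    ; ⁻¹-closed = λ {f} (φ , i , e) → Inv.sym φ , ⁻¹-closed (Inn Γ) {φ} i , λ x →
        trans (sym (strictlyInverseʳ φ (proj₁ (from f x))))
              (from-cong φ (trans (sym (e (from f x))) (strictlyInverseˡ f x)))
    }

  -- The condition under which Inn Γ can be identified with its image InnOn.
  InnFaithfulOn : Set (c ⊔ ℓ ⊔ p)
  InnFaithfulOn = ∀ φ ψ → φ ∈ Mem (Inn Γ) → ψ ∈ Mem (Inn Γ) →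
    (∀ x → x ∈ Mem N → to φ x ≈ to ψ x) → ∀ x → to φ x ≈ to ψ x

record Graph (c ℓ e : Level) : Set (lsuc (c ⊔ ℓ ⊔ e)) where
  field
    vertices : Setoid c ℓ
  open Setoid vertices public using () renaming (Carrier to Vertex; _≈_ to _≈ᵛ_)
  field
    Adj     : Rel Vertex e
    adj-≈   : Adj Respects₂ _≈ᵛ_
    adj-sym : Symmetric Adj
    no-loop : ∀ {x} → ¬ Adj x x

Aut : {e : Level} (X : Graph c ℓ e) → Subgroup (Sym (Graph.vertices X)) (c ⊔ e)
Aut X = record
  { Mem       = λ f → ∀ x y → Adj x y ⇔ Adj (to f x) (to f y)
  ; resp      = λ {f} {g} f≈g a x y → mk⇔
      (λ xy → move (f≈g x) (f≈g y) (Equivalence.to (a x y) xy))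
      (λ xy → Equivalence.from (a x y) (move (V.sym (f≈g x)) (V.sym (f≈g y)) xy))
  ; ε-closed  = λ x y → mk⇔ (λ xy → xy) (λ xy → xy)
  ; ∙-closed  = λ {f} {g} a b x y → mk⇔
      (λ xy → Equivalence.to (a (to g x) (to g y)) (Equivalence.to (b x y) xy))
      (λ xy → Equivalence.from (b x y) (Equivalence.from (a (to g x) (to g y)) xy))
  ; ⁻¹-closed = λ {f} a x y → mk⇔
      (λ xy → Equivalence.from (a (from f x) (from f y))
        (move (V.sym (strictlyInverseˡ f x)) (V.sym (strictlyInverseˡ f y)) xy))
      (λ xy → move (strictlyInverseˡ f x) (strictlyInverseˡ f y)
        (Equivalence.to (a (from f x) (from f y)) xy))
  }
  where
  open Graph X
  open Inverse
  module V = Setoid vertices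
  move : ∀ {x x′ y y′} → x ≈ᵛ x′ → y ≈ᵛ y′ → Adj x y → Adj x′ y′
  move x≈ y≈ xy = proj₁ adj-≈ y≈ (proj₂ adj-≈ x≈ xy)

record ConnectionSet (Γ : Group c ℓ) (p : Level) : Set (c ⊔ ℓ ⊔ lsuc p) where
  open Group Γ
  field
    Mem       : Pred Carrier p
    resp      : Mem Respects _≈_
    ε∉        : ¬ (ε ∈ Mem)
    ⁻¹-closed : ∀ {t} → t ∈ Mem → (t ⁻¹) ∈ Mem

-- The edges are the {x , t x}; T = T⁻¹ makes this orientation immaterial.  The
-- definition does not use the finiteness of Γ.
Cay : (Γ : Group c ℓ) → ConnectionSet Γ p → Graph c ℓ (c ⊔ ℓ ⊔ p)
Cay Γ T = record
  { vertices = setoid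
  ; Adj      = λ x y → ∃[ t ] (t ∈ T.Mem × y ≈ t ∙ x)
  ; adj-≈    = (λ y≈y′ (t , t∈T , e) → t , t∈T , trans (sym y≈y′) e)
             , (λ x≈x′ (t , t∈T , e) → t , t∈T , trans e (∙-congˡ x≈x′))
  ; adj-sym  = λ {x} (t , t∈T , e) → t ⁻¹ , T.⁻¹-closed t∈T ,
      trans (sym (\\-leftDividesʳ t x)) (∙-congˡ (sym e))
  ; no-loop  = λ {x} (t , t∈T , e) →
      T.ε∉ (T.resp (identityˡ-unique t x (sym e)) t∈T)
  }
  where
  open Group Γ
  open GroupProperties Γ
  module T = ConnectionSet T

record Action (H : Group c₁ ℓ₁) (N : Group c₂ ℓ₂) : Set (c₁ ⊔ ℓ₁ ⊔ c₂ ⊔ ℓ₂) where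
  private
    module H = Group H
    module N = Group N
  field
    act      : H.Carrier → N.Carrier → N.Carrier
    act-cong : ∀ {h k x y} → h H.≈ k → x N.≈ y → act h x N.≈ act k y
    act-homo : ∀ h x y → act h (x N.∙ y) N.≈ act h x N.∙ act h y
    act-ε    : ∀ x → act H.ε x N.≈ x
    act-∙    : ∀ h k x → act (h H.∙ k) x N.≈ act h (act k x)

SemidirectProduct : (N : Group c₂ ℓ₂) (H : Group c₁ ℓ₁) → Action H N → Group (c₂ ⊔ c₁) (ℓ₂ ⊔ ℓ₁)
SemidirectProduct N H α = record
  { Carrier = N.Carrier × H.Carrier
  ; _≈_     = λ (x , h) (y , k) → x N.≈ y × h H.≈ k
  ; _∙_     = λ (x , h) (y , k) → x N.∙ act h y , h H.∙ k
  ; ε       = N.ε , H.ε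
  ; _⁻¹     = λ (x , h) → act (h H.⁻¹) (x N.⁻¹) , h H.⁻¹
  ; isGroup = record
    { isMonoid = record
      { isSemigroup = record
        { isMagma = record
          { isEquivalence = record
            { refl  = N.refl , H.refl
            ; sym   = λ (e , d) → N.sym e , H.sym d
            ; trans = λ (e , d) (e′ , d′) → N.trans e e′ , H.trans d d′
            }
          ; ∙-cong = λ (e , d) (e′ , d′) → N.∙-cong e (act-cong d e′) , H.∙-cong d d′
          }
        ; assoc = λ (x , h) (y , k) (z , l) →
            N.trans (N.assoc x (act h y) (act (h H.∙ k) z))
              (N.∙-congˡ (N.trans (N.∙-congˡ (act-∙ h k z)) (N.sym (act-homo h y (act k z)))))
            , H.assoc h k l
        }
      ; identity = (λ (x , h) → N.trans (N.identityˡ _) (act-ε x) , H.identityˡ h)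
                 , (λ (x , h) → N.trans (N.∙-congˡ (act-1 h)) (N.identityʳ x) , H.identityʳ h)
      }
    ; inverse =
        (λ (x , h) → N.trans (N.sym (act-homo (h H.⁻¹) (x N.⁻¹) x))
            (N.trans (act-cong H.refl (N.inverseˡ x)) (act-1 (h H.⁻¹)))
          , H.inverseˡ h)
      , (λ (x , h) → N.trans (N.∙-congˡ (N.trans (N.sym (act-∙ h (h H.⁻¹) (x N.⁻¹)))
            (N.trans (act-cong (H.inverseʳ h) N.refl) (act-ε (x N.⁻¹))))) (N.inverseʳ x)
          , H.inverseʳ h)
    ; ⁻¹-cong = λ (e , d) → act-cong (H.⁻¹-cong d) (N.⁻¹-cong e) , H.⁻¹-cong d
    }
  }
  where
  module N = Group N
  module H = Group H
  open Action α
  act-1 : ∀ h → act h N.ε N.≈ N.ε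
  act-1 h = GroupProperties.identityˡ-unique N (act h N.ε) (act h N.ε)
    (N.trans (N.sym (act-homo h N.ε N.ε)) (act-cong H.refl (N.identityˡ N.ε)))

syntax SemidirectProduct N H α = N ⋊[ α ] H

ℤ₂ : Group 0ℓ 0ℓ
ℤ₂ = ℙ.+-0-group

module _ (Γ : Group c ℓ) (N : Subgroup Γ p) (N-normal : IsNormal Γ N) where
  open Group Γ renaming (inverseˡ to inverseˡ′; inverseʳ to inverseʳ′)
  open GroupProperties Γ
  open ConjProperties Γ
  open SetoidReasoning setoid

  conjAction : Action Γ (asGroup N)
  conjAction = record
    { act      = λ g (x , x∈N) → conj Γ g x , N-normal g x∈N
    ; act-cong = conj-cong
    ; act-homo = λ g (x , _) (y , _) → conj-∙ g x y
    ; act-ε    = λ (x , _) → conj-ε x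
    ; act-∙    = λ g h (x , _) → conj-comp g h x
    }

  -- N ⋊ Γ acts on N with (a , s) acting as x ↦ s x s⁻¹ a⁻¹, the composite of the
  -- conjugation by s and of the right multiplication by a⁻¹ (x ↦ x a would
  -- reverse products).  With h the inversion of N,
  --   (h (a , s) h⁻¹)(x) = (s x⁻¹ s⁻¹ a⁻¹)⁻¹ = a s x s⁻¹ = (as) x (as)⁻¹ (a⁻¹)⁻¹,
  -- so that conjugation by h is (a , s) ↦ (a⁻¹ , a s).
  inversionAction : Action ℤ₂ (asGroup N ⋊[ conjAction ] Γ)
  inversionAction = record
    { act      = act
    ; act-cong = λ { {0ℙ} ≡.refl e → e
                   ; {1ℙ} ≡.refl (e , d) → ⁻¹-cong e , ∙-cong e d }
    ; act-homo = λ { 0ℙ x y → P.refl {P._∙_ x y}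
                   ; 1ℙ ((a , _) , s) ((b , _) , t) → homo₁ a s b t , homo₂ a s b t }
    ; act-ε    = λ x → P.refl {x}
    ; act-∙    = λ { 0ℙ k x → P.refl {act k x}
                   ; 1ℙ 0ℙ x → P.refl {act 1ℙ x}
                   ; 1ℙ 1ℙ ((a , _) , s) → sym (⁻¹-involutive a) , sym (\\-leftDividesʳ a s) }
    }
    where
    module P = Group (asGroup N ⋊[ conjAction ] Γ)

    act : Parity → P.Carrier → P.Carrier
    act 0ℙ x                 = x
    act 1ℙ ((a , a∈N) , s) = (a ⁻¹ , ⁻¹-closed N a∈N) , a ∙ s

    homo₁ : ∀ a s b t → (a ∙ conj Γ s b) ⁻¹ ≈ a ⁻¹ ∙ conj Γ (a ∙ s) (b ⁻¹)
    homo₁ a s b t = begin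
      (a ∙ conj Γ s b) ⁻¹                    ≈⟨ ⁻¹-anti-homo-∙ a (conj Γ s b) ⟩
      conj Γ s b ⁻¹ ∙ a ⁻¹                   ≈⟨ ∙-congʳ (conj-⁻¹ s b) ⟨
      conj Γ s (b ⁻¹) ∙ a ⁻¹                 ≈⟨ \\-leftDividesʳ a _ ⟨
      a ⁻¹ ∙ (a ∙ (conj Γ s (b ⁻¹) ∙ a ⁻¹))  ≈⟨ ∙-congˡ (assoc a _ _) ⟨
      a ⁻¹ ∙ conj Γ a (conj Γ s (b ⁻¹))      ≈⟨ ∙-congˡ (conj-comp a s (b ⁻¹)) ⟨
      a ⁻¹ ∙ conj Γ (a ∙ s) (b ⁻¹)           ∎

    homo₂ : ∀ a s b t → (a ∙ conj Γ s b) ∙ (s ∙ t) ≈ (a ∙ s) ∙ (b ∙ t)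
    homo₂ a s b t = begin
      (a ∙ (s ∙ b ∙ s ⁻¹)) ∙ (s ∙ t)   ≈⟨ assoc a _ _ ⟩
      a ∙ ((s ∙ b ∙ s ⁻¹) ∙ (s ∙ t))   ≈⟨ ∙-congˡ (cancel-mid (s ∙ b) s t) ⟩
      a ∙ ((s ∙ b) ∙ t)                ≈⟨ ∙-congˡ (assoc s b t) ⟩
      a ∙ (s ∙ (b ∙ t))                ≈⟨ assoc a s (b ∙ t) ⟨
      (a ∙ s) ∙ (b ∙ t)                ∎

S : ℕ → Group 0ℓ 0ℓ
S n = Sym (≡.setoid (Fin n))

private
  variable
    n : ℕ

-- A TranspositionList may contain (i , i), which evaluates to the identity and
-- would make the parity of the length meaningless.
Proper : TranspositionList n → Set
Proper = All (λ (i , j) → i ≢ j)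

IsEven : Permutation′ n → Set
IsEven {n} σ = ∃[ ts ] (Proper {n} ts × 2 ∣ length ts × (∀ k → eval ts ⟨$⟩ʳ k ≡ σ ⟨$⟩ʳ k))

private
  eval-++ : ∀ (xs ys : TranspositionList n) k →
            eval (xs ++ ys) ⟨$⟩ʳ k ≡ eval ys ⟨$⟩ʳ (eval xs ⟨$⟩ʳ k)
  eval-++ []             ys k = ≡.refl
  eval-++ ((i , j) ∷ xs) ys k = eval-++ xs ys (PC.transpose i j k)

  invert : ∀ (xs : TranspositionList n) → Proper xs →
           ∃[ ys ] (Proper {n} ys × length ys ≡ length xs ×
                    (∀ k → eval ys ⟨$⟩ʳ (eval xs ⟨$⟩ʳ k) ≡ k))
  invert []             []       = [] , [] , ≡.refl , λ k → ≡.refl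
  invert ((i , j) ∷ xs) (i≢j ∷ p) with invert xs p
  ... | ys , q , len , e =
    ys ++ (j , i) ∷ [] , ++⁺ q ((λ j≡i → i≢j (≡.sym j≡i)) ∷ []) ,
    ≡.trans (length-++ ys) (≡.trans (+-comm (length ys) 1) (≡.cong suc len)) ,
    λ k → ≡.trans (eval-++ ys ((j , i) ∷ []) _)
            (≡.trans (≡.cong (PC.transpose j i) (e (PC.transpose i j k)))
                     (PC.transpose-inverse j i))

  σ-injective : ∀ (σ : Permutation′ n) {i j} → σ ⟨$⟩ʳ i ≡ σ ⟨$⟩ʳ j → i ≡ j
  σ-injective σ e = ≡.trans (≡.sym (inverseˡ σ)) (≡.trans (≡.cong (Inverse.from σ) e) (inverseˡ σ))

  transpose-equivariant : ∀ (σ : Permutation′ n) i j k →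
    PC.transpose (σ ⟨$⟩ʳ i) (σ ⟨$⟩ʳ j) (σ ⟨$⟩ʳ k) ≡ σ ⟨$⟩ʳ PC.transpose i j k
  transpose-equivariant σ i j k
    with k ≟ i | (σ ⟨$⟩ʳ k) ≟ (σ ⟨$⟩ʳ i)
  ... | yes _   | yes _ = ≡.refl
  ... | yes k≡i | no ne = contradiction (≡.cong (σ ⟨$⟩ʳ_) k≡i) ne
  ... | no ne   | yes e = contradiction (σ-injective σ e) ne
  ... | no _    | no _ with k ≟ j | (σ ⟨$⟩ʳ k) ≟ (σ ⟨$⟩ʳ j)
  ...   | yes _   | yes _ = ≡.refl
  ...   | yes k≡j | no ne = contradiction (≡.cong (σ ⟨$⟩ʳ_) k≡j) ne
  ...   | no ne   | yes e = contradiction (σ-injective σ e) ne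
  ...   | no _    | no _  = ≡.refl

  relabel : Permutation′ n → TranspositionList n → TranspositionList n
  relabel σ = map (λ (i , j) → σ ⟨$⟩ʳ i , σ ⟨$⟩ʳ j)

  relabel-proper : ∀ (σ : Permutation′ n) {xs} → Proper xs → Proper (relabel σ xs)
  relabel-proper σ []       = []
  relabel-proper σ (ne ∷ p) = (λ e → ne (σ-injective σ e)) ∷ relabel-proper σ p

  eval-relabel : ∀ (σ : Permutation′ n) xs k →
                 eval (relabel σ xs) ⟨$⟩ʳ (σ ⟨$⟩ʳ k) ≡ σ ⟨$⟩ʳ (eval xs ⟨$⟩ʳ k)
  eval-relabel σ []             k = ≡.refl
  eval-relabel σ ((i , j) ∷ xs) k =
    ≡.trans (≡.cong (eval (relabel σ xs) ⟨$⟩ʳ_) (transpose-equivariant σ i j k))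
            (eval-relabel σ xs (PC.transpose i j k))

Alt : ∀ n → Subgroup (S n) 0ℓ
Alt n = record
  { Mem       = IsEven
  ; resp      = λ σ≈τ (ts , p , e , v) → ts , p , e , λ k → ≡.trans (v k) (σ≈τ k)
  ; ε-closed  = [] , [] , divides 0 ≡.refl , λ k → ≡.refl
  ; ∙-closed  = λ {σ} {τ} (xs , p , e , v) (ys , q , d , w) →
      ys ++ xs , ++⁺ q p ,
      ≡.subst (2 ∣_) (≡.sym (length-++ ys)) (∣m∣n⇒∣m+n d e) ,
      λ k → ≡.trans (eval-++ ys xs k)
              (≡.trans (≡.cong (eval xs ⟨$⟩ʳ_) (w k)) (v (τ ⟨$⟩ʳ k)))
  ; ⁻¹-closed = λ {σ} (xs , p , e , v) →
      let (ys , q , len , w) = invert xs p in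
      ys , q , ≡.subst (2 ∣_) (≡.sym len) e ,
      λ k → ≡.trans (≡.cong (eval ys ⟨$⟩ʳ_)
                      (≡.sym (≡.trans (v (Inverse.from σ k)) (inverseʳ σ))))
              (w (Inverse.from σ k))
  }

Alt-normal : ∀ n → IsNormal (S n) (Alt n)
Alt-normal n σ {τ} (xs , p , e , v) =
  relabel σ xs , relabel-proper σ p ,
  ≡.subst (2 ∣_) (≡.sym (length-map _ xs)) e ,
  λ k → ≡.trans (≡.cong (eval (relabel σ xs) ⟨$⟩ʳ_) (≡.sym (inverseʳ σ)))
          (≡.trans (eval-relabel σ xs (Inverse.from σ k))
                   (≡.cong (σ ⟨$⟩ʳ_) (v (Inverse.from σ k))))

A : ℕ → Group 0ℓ 0ℓ
A n = asGroup (Alt n)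

record IsThreeCycle (σ : Permutation′ n) : Set where
  field
    p₁ p₂ p₃ : Fin n
    p₁≢p₂    : p₁ ≢ p₂
    p₂≢p₃    : p₂ ≢ p₃
    p₁≢p₃    : p₁ ≢ p₃
    p₁↦p₂    : σ ⟨$⟩ʳ p₁ ≡ p₂
    p₂↦p₃    : σ ⟨$⟩ʳ p₂ ≡ p₃
    p₃↦p₁    : σ ⟨$⟩ʳ p₃ ≡ p₁
    fixes    : ∀ k → k ≢ p₁ → k ≢ p₂ → k ≢ p₃ → σ ⟨$⟩ʳ k ≡ k

-- Every 3-cycle is even, so this is the set of all 3-cycles of S n.
threeCycles : ∀ n → ConnectionSet (A n) 0ℓ
threeCycles n = record
  { Mem       = λ (σ , _) → IsThreeCycle σ
  ; resp      = λ σ≈τ t → let open IsThreeCycle t in record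
      { p₁ = p₁ ; p₂ = p₂ ; p₃ = p₃ ; p₁≢p₂ = p₁≢p₂ ; p₂≢p₃ = p₂≢p₃ ; p₁≢p₃ = p₁≢p₃
      ; p₁↦p₂ = ≡.trans (≡.sym (σ≈τ p₁)) p₁↦p₂
      ; p₂↦p₃ = ≡.trans (≡.sym (σ≈τ p₂)) p₂↦p₃
      ; p₃↦p₁ = ≡.trans (≡.sym (σ≈τ p₃)) p₃↦p₁
      ; fixes = λ k k≢p₁ k≢p₂ k≢p₃ → ≡.trans (≡.sym (σ≈τ k)) (fixes k k≢p₁ k≢p₂ k≢p₃)
      }
  ; ε∉        = λ t → IsThreeCycle.p₁≢p₂ t (IsThreeCycle.p₁↦p₂ t)
  ; ⁻¹-closed = λ { {σ , _} t → let open IsThreeCycle t in record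
      { p₁ = p₁ ; p₂ = p₃ ; p₃ = p₂
      ; p₁≢p₂ = p₁≢p₃ ; p₂≢p₃ = λ p₃≡p₂ → p₂≢p₃ (≡.sym p₃≡p₂) ; p₁≢p₃ = p₁≢p₂
      ; p₁↦p₂ = back σ p₃↦p₁
      ; p₂↦p₃ = back σ p₂↦p₃
      ; p₃↦p₁ = back σ p₁↦p₂
      ; fixes = λ k k≢p₁ k≢p₃ k≢p₂ → back σ (fixes k k≢p₁ k≢p₂ k≢p₃)
      } }
  }
  where
  back : ∀ (σ : Permutation′ n) {i j} → σ ⟨$⟩ʳ i ≡ j → Inverse.from σ j ≡ i
  back σ e = ≡.trans (≡.cong (Inverse.from σ) (≡.sym e)) (inverseˡ σ)

CAG : ∀ n → Graph 0ℓ 0ℓ 0ℓ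
CAG n = Cay (A n) (threeCycles n)

{-# OPTIONS --safe #-}

-- A right multiplication x ↦ x a⁻¹ of N, a conjugation x ↦ s x s⁻¹ and the inversion
-- satisfy the commutation relations that define the action of Γ on N and that of ℤ₂ on
-- N ⋊ Γ, so they assemble into a homomorphism (N ⋊ Γ) ⋊ ℤ₂ → Sym N, whose image is L.
-- If x ↦ s x s⁻¹ a⁻¹ is the identity, then a = e (take x = e) and s centralizes N; if
-- x ↦ s x⁻¹ s⁻¹ a⁻¹ is the identity, then a = e and the identity x ↦ s x⁻¹ s⁻¹ of N is an
-- anti-homomorphism, so N is abelian and centralizes itself.  Hence the kernel is trivial
-- when N ≠ 1 has trivial centralizer in Γ.  For N = Aₙ, n ≥ 4, this holds since a
-- permutation moving i to j ≠ i does not commute with a 3-cycle that moves j and fixes i;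
-- such a 3-cycle needs two further points.  The three kinds of maps are graph
-- automorphisms because conjugation preserves 3-cycles.

module Submission where

open import Defs
open import Data.Nat.Base using (ℕ; _≥_)
open import Data.Product.Base using (Σ; _×_)
open import Level using (0ℓ)
open import Relation.Unary using (_⊆_)
open import Algebra.Bundles using (Group)
open import Algebra.Morphism.Structures using (IsGroupHomomorphism; IsGroupMonomorphism)
import Algebra.Properties.Group as GroupProperties
open import Data.Fin.Base using (Fin)
open import Data.Fin.Permutation using (Permutation′; _⟨$⟩ʳ_; inverseˡ; inverseʳ)
import Data.Fin.Permutation.Components as PC
open import Data.Fin.Permutation.Transposition.List using (TranspositionList; eval)
open import Data.Fin.Properties using (_≟_; ¬∀⟶∃¬; injective⇒≤)
open import Data.List.Base using (List; []; _∷_; length)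
import Data.List.Membership.DecPropositional as DecMembership
open import Data.List.Membership.Propositional using (_∉_)
import Data.List.Membership.Setoid.Properties as Membership
open import Data.List.Relation.Unary.All using ([]; _∷_)
open import Data.List.Relation.Unary.Any using (here; there; index)
open import Data.Nat.Base using (_<_; s≤s; z≤n)
open import Data.Nat.Divisibility using (divides)
open import Data.Nat.Properties using (<-≤-trans; ≤⇒≯)
open import Data.Parity.Base using (Parity; 0ℙ; 1ℙ)
open import Data.Product.Base using (∃-syntax; _,_; proj₁; proj₂)
open import Function.Bundles using (Inverse; Equivalence; _⇔_; mk⇔)
open import Level using (Level; _⊔_)
open import Relation.Binary.PropositionalEquality as ≡ using (_≡_; _≢_)
import Relation.Binary.Reasoning.Setoid as SetoidReasoning
open import Relation.Nullary.Decidable using (decidable-stable; dec-true; dec-false)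
open import Relation.Nullary.Negation using (¬_; contradiction)

private
  variable
    c ℓ c₁ ℓ₁ c₂ ℓ₂ p q r : Level

-- Homomorphisms, kernels and images.

module _ (G : Group c₁ ℓ₁) (H : Group c₂ ℓ₂) where
  private
    module G = Group G
    module H = Group H

  Homomorphism Monomorphism : (G.Carrier → H.Carrier) → Set (c₁ ⊔ ℓ₁ ⊔ ℓ₂)
  Homomorphism = IsGroupHomomorphism G.rawGroup H.rawGroup
  Monomorphism = IsGroupMonomorphism G.rawGroup H.rawGroup

  -- Subgroups such as `RightRegular` and `⟨_⟩` carry membership predicates of their own, so being
  -- an image is a logical equivalence rather than an equality with `image`.
  IsImage : (G.Carrier → H.Carrier) → Subgroup H p → Set (c₁ ⊔ c₂ ⊔ ℓ₂ ⊔ p)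
  IsImage f P = ∀ y → Mem P y ⇔ (∃[ x ] y H.≈ f x)

  ∙-homo⇒homomorphism : ∀ {f} → (∀ {x y} → x G.≈ y → f x H.≈ f y) →
                        (∀ x y → f (x G.∙ y) H.≈ f x H.∙ f y) → Homomorphism f
  ∙-homo⇒homomorphism {f} f-cong f-∙ = record
    { isMonoidHomomorphism = record
      { isMagmaHomomorphism = record
        { isRelHomomorphism = record { cong = f-cong } ; homo = f-∙ }
      ; ε-homo = f-ε
      }
    ; ⁻¹-homo = λ x → GroupProperties.inverseˡ-unique H _ _
        (H.trans (H.sym (f-∙ (x G.⁻¹) x)) (H.trans (f-cong (G.inverseˡ x)) f-ε))
    }
    where
    f-ε : f G.ε H.≈ H.ε
    f-ε = GroupProperties.identityˡ-unique H _ _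
      (H.trans (H.sym (f-∙ G.ε G.ε)) (f-cong (G.identityˡ G.ε)))

  trivialKernel⇒monomorphism : ∀ {f} → Homomorphism f →
                               (∀ {x} → f x H.≈ H.ε → x G.≈ G.ε) → Monomorphism f
  trivialKernel⇒monomorphism hom ker = record
    { isGroupHomomorphism = hom
    ; injective = λ {x} {y} fx≈fy → GroupProperties.x∙y⁻¹≈ε⇒x≈y G x y
        (ker (H.trans (homo x (y G.⁻¹))
             (H.trans (H.∙-congˡ (⁻¹-homo y)) (GroupProperties.x≈y⇒x∙y⁻¹≈ε H fx≈fy))))
    }
    where open IsGroupHomomorphism hom

module _ (G : Group c₁ ℓ₁) (H : Group c₂ ℓ₂) {f : Group.Carrier G → Group.Carrier H} where
  private
    module G = Group G
    module H = Group H

  image : Homomorphism G H f → Subgroup H (c₁ ⊔ ℓ₂)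
  image hom = record
    { Mem       = λ y → ∃[ x ] y H.≈ f x
    ; resp      = λ y≈y′ (x , e) → x , H.trans (H.sym y≈y′) e
    ; ε-closed  = G.ε , H.sym ε-homo
    ; ∙-closed  = λ (x , e) (x′ , e′) → x G.∙ x′ , H.trans (H.∙-cong e e′) (H.sym (homo x x′))
    ; ⁻¹-closed = λ (x , e) → x G.⁻¹ , H.trans (H.⁻¹-cong e) (H.sym (⁻¹-homo x))
    }
    where open IsGroupHomomorphism hom

  image-isImage : (hom : Homomorphism G H f) → IsImage G H f (image hom)
  image-isImage hom _ = mk⇔ (λ y → y) (λ y → y)

  -- The inverse isomorphism reads off the preimage stored in a proof of membership; injectivity of
  -- `f` makes it independent of that proof.
  image≅domain : Monomorphism G H f → {P : Subgroup H p} → IsImage G H f P → asGroup P ≅ G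
  image≅domain mono {P} im = preimage , record
    { isGroupMonomorphism = record
      { isGroupHomomorphism = ∙-homo⇒homomorphism (asGroup P) G
          (λ {y} {z} y≈z → injective
            (H.trans (H.sym (preimage-≈ y)) (H.trans y≈z (preimage-≈ z))))
          (λ y z → injective
            (H.trans (H.sym (preimage-≈ (Group._∙_ (asGroup P) y z)))
            (H.trans (H.∙-cong (preimage-≈ y) (preimage-≈ z)) (H.sym (∙-homo _ _)))))
      ; injective = λ {y} {z} e →
          H.trans (preimage-≈ y) (H.trans (⟦⟧-cong e) (H.sym (preimage-≈ z)))
      }
    ; surjective = λ x → (f x , Equivalence.from (im _) (x , H.refl)) , λ {z} z≈ →
        injective (H.trans (H.sym (preimage-≈ z)) z≈)
    }
    where
    open IsGroupMonomorphism mono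
    preimage : Group.Carrier (asGroup P) → G.Carrier
    preimage (y , y∈P) = proj₁ (Equivalence.to (im _) y∈P)
    preimage-≈ : ∀ y → proj₁ y H.≈ f (preimage y)
    preimage-≈ (y , y∈P) = proj₂ (Equivalence.to (im _) y∈P)

module _ (G : Group c ℓ) (P : Subgroup G p) where

  generated-minimal : ∀ {g} → Mem P g → Generated G g ⊆ Mem P
  generated-minimal g∈P gen        = g∈P
  generated-minimal g∈P unit       = ε-closed P
  generated-minimal g∈P (mul u v)  = ∙-closed P (generated-minimal g∈P u) (generated-minimal g∈P v)
  generated-minimal g∈P (inv u)    = ⁻¹-closed P (generated-minimal g∈P u)
  generated-minimal g∈P (eq x≈y u) = resp P x≈y (generated-minimal g∈P u)

-- Homomorphisms out of a semidirect product.

module _ {N : Group c₁ ℓ₁} {H : Group c₂ ℓ₂} (α : Action H N) (G : Group c ℓ) where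
  open Group G
  open Action α

  -- The defining relation `h n h⁻¹ = act h n` of the semidirect product, transported to `G` and
  -- written without inverses.
  Intertwines : (Group.Carrier N → Carrier) → (Group.Carrier H → Carrier) → Set (c₁ ⊔ c₂ ⊔ ℓ)
  Intertwines f g = ∀ h n → g h ∙ f n ≈ f (act h n) ∙ g h

module SemidirectLift
  {N : Group c₁ ℓ₁} {H : Group c₂ ℓ₂} (α : Action H N) {G : Group c ℓ}
  {f : Group.Carrier N → Group.Carrier G} {g : Group.Carrier H → Group.Carrier G}
  (f-homo : Homomorphism N G f) (g-homo : Homomorphism H G g)
  (intertwines : Intertwines α G f g)
  where

  open Group G
  open Action α
  private
    module N = Group N
    module H = Group H
    module N⋊H = Group (N ⋊[ α ] H)
    module f = IsGroupHomomorphism f-homo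
    module g = IsGroupHomomorphism g-homo

  lift : N⋊H.Carrier → Carrier
  lift (n , h) = f n ∙ g h

  lift-∙ : ∀ x y → lift (x N⋊H.∙ y) ≈ lift x ∙ lift y
  lift-∙ (n , h) (m , k) = begin
    f (n N.∙ act h m) ∙ g (h H.∙ k)    ≈⟨ ∙-cong (f.homo n (act h m)) (g.homo h k) ⟩
    f n ∙ f (act h m) ∙ (g h ∙ g k)    ≈⟨ assoc (f n ∙ f (act h m)) (g h) (g k) ⟨
    f n ∙ f (act h m) ∙ g h ∙ g k      ≈⟨ ∙-congʳ (assoc (f n) (f (act h m)) (g h)) ⟩
    f n ∙ (f (act h m) ∙ g h) ∙ g k    ≈⟨ ∙-congʳ (∙-congˡ (intertwines h m)) ⟨
    f n ∙ (g h ∙ f m) ∙ g k            ≈⟨ ∙-congʳ (assoc (f n) (g h) (f m)) ⟨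
    f n ∙ g h ∙ f m ∙ g k              ≈⟨ assoc (f n ∙ g h) (f m) (g k) ⟩
    (f n ∙ g h) ∙ (f m ∙ g k)          ∎
    where open SetoidReasoning setoid

  lift-homo : Homomorphism (N ⋊[ α ] H) G lift
  lift-homo = ∙-homo⇒homomorphism (N ⋊[ α ] H) G
    (λ (e , d) → ∙-cong (f.⟦⟧-cong e) (g.⟦⟧-cong d)) lift-∙

  lift-inl : ∀ n → lift (n , H.ε) ≈ f n
  lift-inl n = trans (∙-congˡ g.ε-homo) (identityʳ (f n))

  lift-inr : ∀ h → lift (N.ε , h) ≈ g h
  lift-inr h = trans (∙-congʳ f.ε-homo) (identityˡ (g h))

  module _ (mono : Monomorphism (N ⋊[ α ] H) G lift) where
    open IsGroupMonomorphism mono using (injective; ⟦⟧-cong; ⁻¹-homo)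

    -- For `inversionPower` this identifies the group generated by the inversion with `ℤ₂`; for
    -- `conjugation` it gives the faithfulness of the inner automorphisms.
    inr-mono : Monomorphism H G g
    inr-mono = record
      { isGroupHomomorphism = g-homo
      ; injective = λ {h} {k} e → proj₂ (injective {N.ε , h} {N.ε , k}
          (trans (lift-inr h) (trans e (sym (lift-inr k)))))
      }

    -- The lift carries the factors of the semidirect product to `P` and `Q`. Normality: a conjugate
    -- of `(n , ε)` has second component `h ε h⁻¹ = ε`. Trivial intersection: a common element is
    -- the image of some `(n , ε)` and of some `(ε , h)`, which coincide by injectivity.
    isInternalSemidirect : {P : Subgroup G p} {Q : Subgroup G q} {K : Subgroup G r} →
      IsImage N G f P → IsImage H G g Q → IsImage (N ⋊[ α ] H) G lift K →
      IsInternalSemidirect G P Q K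
    isInternalSemidirect im-P im-Q im-K = record
      { N⊆K = λ x∈P → let (n , e) = Equivalence.to (im-P _) x∈P in
          Equivalence.from (im-K _) ((n , H.ε) , trans e (sym (lift-inl n)))
      ; H⊆K = λ y∈Q → let (h , e) = Equivalence.to (im-Q _) y∈Q in
          Equivalence.from (im-K _) ((N.ε , h) , trans e (sym (lift-inr h)))
      ; normal = λ k∈K x∈P → let
            (a , e) = Equivalence.to (im-K _) k∈K
            (n , d) = Equivalence.to (im-P _) x∈P
          in Equivalence.from (im-P _) (_ , trans (conj-lift a n e d)
              (trans (⟦⟧-cong (N.refl , conj-ε₂ (proj₂ a))) (lift-inl _)))
      ; trivial = λ x∈P x∈Q → let
            (n , e) = Equivalence.to (im-P _) x∈P
            (h , d) = Equivalence.to (im-Q _) x∈Q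
            (n≈ε , _) = injective {n , H.ε} {N.ε , h}
              (trans (lift-inl n) (trans (sym e) (trans d (sym (lift-inr h)))))
          in trans e (trans (f.⟦⟧-cong n≈ε) f.ε-homo)
      ; K⊆NH = λ k∈K → let ((n , h) , e) = Equivalence.to (im-K _) k∈K in
          f n , g h , Equivalence.from (im-P _) (n , refl) , Equivalence.from (im-Q _) (h , refl) , e
      }
      where
      conj-ε₂ : ∀ h → conj H h H.ε H.≈ H.ε
      conj-ε₂ h = H.trans (H.∙-congʳ (H.identityʳ h)) (H.inverseʳ h)
      conj-lift : ∀ a n {k x} → k ≈ lift a → x ≈ f n →
                  conj G k x ≈ lift (conj (N ⋊[ α ] H) a (n , H.ε))
      conj-lift a n e d =
        trans (∙-cong (∙-cong e (trans d (sym (lift-inl n)))) (⁻¹-cong e))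
        (sym (trans (lift-∙ _ _) (∙-cong (lift-∙ _ _) (⁻¹-homo a))))

-- Inner automorphisms and automorphisms of Cayley graphs.

module _ (Γ : Group c ℓ) where
  open Group Γ
  open ConjProperties Γ

  conj-identity : ∀ g → conj Γ g ε ≈ ε
  conj-identity g = trans (∙-congʳ (identityʳ g)) (Group.inverseʳ Γ g)

  conj-inverse′ : ∀ g x → conj Γ g (conj Γ (g ⁻¹) x) ≈ x
  conj-inverse′ g x = trans (conj-cong (sym (GroupProperties.⁻¹-involutive Γ g)) refl)
                            (conj-inverse (g ⁻¹) x)

  commute⇒conj≈ : ∀ {g x} → g ∙ x ≈ x ∙ g → conj Γ g x ≈ x
  commute⇒conj≈ {g} {x} e = trans (∙-congʳ e) (GroupProperties.//-rightDividesʳ Γ g x)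

  innerPerm : Carrier → Inverse setoid setoid
  innerPerm g = record
    { to        = conj Γ g
    ; from      = conj Γ (g ⁻¹)
    ; to-cong   = conj-cong refl
    ; from-cong = conj-cong refl
    ; inverse   = (λ {x} e → trans (conj-cong refl e) (conj-inverse′ g x))
                , (λ {x} e → trans (conj-cong refl e) (conj-inverse g x))
    }

module _ (Γ : Group c ℓ) (T : ConnectionSet Γ p) where
  private module T = ConnectionSet T
  open Graph (Cay Γ T)
  open Group Γ
  open GroupProperties Γ
  open ConjProperties Γ
  open Inverse

  Preserves : (Carrier → Carrier) → Set (c ⊔ ℓ ⊔ p)
  Preserves f = ∀ {x y} → Adj x y → Adj (f x) (f y)

  -- Reflection of edges by `f` is preservation of edges by its inverse.
  preserves⇒aut : ∀ f → Preserves (to f) → Preserves (from f) → Mem (Aut (Cay Γ T)) f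
  preserves⇒aut f pres-to pres-from x y = mk⇔ pres-to λ fxfy →
    proj₁ adj-≈ (strictlyInverseʳ f y) (proj₂ adj-≈ (strictlyInverseʳ f x) (pres-from fxfy))

  rightMul-preserves : ∀ γ → Preserves (_∙ γ)
  rightMul-preserves γ {x} (t , t∈T , e) = t , t∈T , trans (∙-congʳ e) (assoc t x γ)

  -- From `y = t x` follows `y⁻¹ = x⁻¹ t⁻¹ = (x⁻¹ t⁻¹ x) x⁻¹`, so the new edge is labelled by a
  -- conjugate of `t⁻¹`.
  inversion-preserves : (∀ g {t} → T.Mem t → T.Mem (conj Γ g t)) → Preserves _⁻¹
  inversion-preserves T-conj {x} {y} (t , t∈T , e) =
    conj Γ (x ⁻¹) (t ⁻¹) , T-conj (x ⁻¹) (T.⁻¹-closed t∈T) ,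
    trans (trans (⁻¹-cong e) (⁻¹-anti-homo-∙ t x)) (sym (//-rightDividesˡ (x ⁻¹) _))

  rightRegular⊆aut : Mem (RightRegular Γ) ⊆ Mem (Aut (Cay Γ T))
  rightRegular⊆aut {f} (γ , e) =
    resp (Aut (Cay Γ T)) {rightMul Γ γ} {f} (λ x → sym (e x))
      (preserves⇒aut (rightMul Γ γ) (rightMul-preserves γ) (rightMul-preserves (γ ⁻¹)))

  inversion∈aut : (∀ g {t} → T.Mem t → T.Mem (conj Γ g t)) → Mem (Aut (Cay Γ T)) (inversion Γ)
  inversion∈aut T-conj = preserves⇒aut (inversion Γ)
    (inversion-preserves T-conj) (inversion-preserves T-conj)

-- Translations, conjugations and inversion as permutations of a normal subgroup.

module NormalSubgroup (Γ : Group c ℓ) (N : Subgroup Γ p) (N-normal : IsNormal Γ N) where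
  open Group Γ
  open GroupProperties Γ
  open ConjProperties Γ
  open SetoidReasoning setoid

  private
    𝑁 : Group (c ⊔ p) ℓ
    𝑁 = asGroup N
    module 𝑁 = Group 𝑁

  𝕊 : Group (c ⊔ ℓ ⊔ p) (c ⊔ ℓ ⊔ p)
  𝕊 = Sym 𝑁.setoid
  private module 𝕊 = Group 𝕊

  conjugation : Carrier → 𝕊.Carrier
  conjugation s = record
    { to        = λ (x , x∈N) → conj Γ s x , N-normal s x∈N
    ; from      = λ (x , x∈N) → conj Γ (s ⁻¹) x , N-normal (s ⁻¹) x∈N
    ; to-cong   = φ.to-cong
    ; from-cong = φ.from-cong
    ; inverse   = (λ {x} → φ.inverseˡ {proj₁ x}) , (λ {x} → φ.inverseʳ {proj₁ x})
    }
    where module φ = Inverse (innerPerm Γ s)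

  -- Multiplication by a itself would be an anti-homomorphism.
  translation : 𝑁.Carrier → 𝕊.Carrier
  translation a = rightMul 𝑁 (a 𝑁.⁻¹)

  inversionPower : Parity → 𝕊.Carrier
  inversionPower 0ℙ = 𝕊.ε
  inversionPower 1ℙ = inversion 𝑁

  conjugation-homo : Homomorphism Γ 𝕊 conjugation
  conjugation-homo = ∙-homo⇒homomorphism Γ 𝕊
    (λ s≈t _ → conj-cong s≈t refl) (λ s t x → conj-comp s t (proj₁ x))

  translation-homo : Homomorphism 𝑁 𝕊 translation
  translation-homo = ∙-homo⇒homomorphism 𝑁 𝕊
    (λ a≈b _ → ∙-congˡ (⁻¹-cong a≈b))
    (λ (a , _) (b , _) (x , _) →
      trans (∙-congˡ (⁻¹-anti-homo-∙ a b)) (sym (assoc x (b ⁻¹) (a ⁻¹))))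

  inversionPower-homo : Homomorphism ℤ₂ 𝕊 inversionPower
  inversionPower-homo = ∙-homo⇒homomorphism ℤ₂ 𝕊
    (λ { {x} ≡.refl → 𝕊.refl {inversionPower x} })
    (λ { 0ℙ k x → refl ; 1ℙ 0ℙ x → refl ; 1ℙ 1ℙ x → sym (⁻¹-involutive (proj₁ x)) })

  conjugation-translation :
    Intertwines (conjAction Γ N N-normal) 𝕊 translation conjugation
  conjugation-translation s (a , _) (x , _) =
    trans (conj-∙ s x (a ⁻¹)) (∙-congˡ (conj-⁻¹ s a))

  module Affine = SemidirectLift (conjAction Γ N N-normal)
    {G = 𝕊} {f = translation} {g = conjugation}
    translation-homo conjugation-homo conjugation-translation

  inversion-affine : Intertwines (inversionAction Γ N N-normal) 𝕊 Affine.lift inversionPower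
  inversion-affine 0ℙ x y = refl
  inversion-affine 1ℙ ((a , _) , s) (x , _) = begin
    (conj Γ s x ∙ a ⁻¹) ⁻¹                  ≈⟨ ⁻¹-anti-homo-∙ (conj Γ s x) (a ⁻¹) ⟩
    a ⁻¹ ⁻¹ ∙ conj Γ s x ⁻¹                 ≈⟨ ∙-cong (⁻¹-involutive a) (sym (conj-⁻¹ s x)) ⟩
    -- Multiplying by `a⁻¹` and then by its inverse completes the left factor `a` to a conjugation
    -- by `a`, which merges with the one by `s`.
    a ∙ conj Γ s (x ⁻¹)                     ≈⟨ //-rightDividesʳ (a ⁻¹) _ ⟨
    conj Γ a (conj Γ s (x ⁻¹)) ∙ a ⁻¹ ⁻¹    ≈⟨ ∙-congʳ (conj-comp a s (x ⁻¹)) ⟨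
    conj Γ (a ∙ s) (x ⁻¹) ∙ a ⁻¹ ⁻¹         ∎

  module Full = SemidirectLift (inversionAction Γ N N-normal)
    {G = 𝕊} {f = Affine.lift} {g = inversionPower}
    Affine.lift-homo inversionPower-homo inversion-affine

  AffineGroup FullGroup : Group _ _
  AffineGroup = 𝑁 ⋊[ conjAction Γ N N-normal ] Γ
  FullGroup   = AffineGroup ⋊[ inversionAction Γ N N-normal ] ℤ₂

  -- Since `γ ↦ γ⁻¹` is a bijection, the inverse built into `translation` reparametrizes the right
  -- multiplications without changing their set.
  rightRegular-isImage : IsImage 𝑁 𝕊 translation (RightRegular 𝑁)
  rightRegular-isImage _ = mk⇔
    (λ (γ , e) → γ 𝑁.⁻¹ , λ x → trans (e x) (∙-congˡ (sym (⁻¹-involutive (proj₁ γ)))))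
    (λ (a , e) → a 𝑁.⁻¹ , e)

  innOn-isImage : IsImage Γ 𝕊 conjugation (InnOn Γ N)
  innOn-isImage _ = mk⇔
    (λ (φ , (s , e) , restr) → s , λ x → trans (restr x) (e (proj₁ x)))
    (λ (s , e) → innerPerm Γ s , (s , λ x → refl) , e)

  power⇒generated : ∀ {f} → ∃[ k ] f 𝕊.≈ inversionPower k → Generated 𝕊 (inversion 𝑁) f
  power⇒generated {f} (0ℙ , e) = eq {y = f} (λ x → sym (e x)) unit
  power⇒generated {f} (1ℙ , e) = eq {y = f} (λ x → sym (e x)) gen

  -- The inversion is an involution, so the identity and the inversion already form a subgroup, and
  -- the generated subgroup is the least one containing the inversion.
  generated-isImage : IsImage ℤ₂ 𝕊 inversionPower (⟨_⟩ 𝕊 (inversion 𝑁))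
  generated-isImage _ = mk⇔
    (generated-minimal 𝕊 (image ℤ₂ 𝕊 inversionPower-homo)
      {inversion 𝑁} (1ℙ , λ x → refl))
    power⇒generated

  -- Injectivity of the lifts when the centralizer is trivial.

  module TrivialCentralizer
    (centralizer-trivial : ∀ s → (∀ {x} → Mem N x → conj Γ s x ≈ x) → s ≈ ε)
    (nontrivial : ∃[ x ] (Mem N x × ¬ (x ≈ ε)))
    where

    affine-kernel : ∀ {x} → Affine.lift x 𝕊.≈ 𝕊.ε → proj₁ (proj₁ x) ≈ ε × proj₂ x ≈ ε
    affine-kernel {(a , _) , s} e = a≈ε , centralizer-trivial s λ {x} x∈N → begin
        conj Γ s x           ≈⟨ identityʳ _ ⟨
        conj Γ s x ∙ ε       ≈⟨ ∙-congˡ (trans (⁻¹-cong a≈ε) ε⁻¹≈ε) ⟨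
        conj Γ s x ∙ a ⁻¹    ≈⟨ e (x , x∈N) ⟩
        x                    ∎
      where
      a≈ε : a ≈ ε
      a≈ε = ⁻¹-injective (begin
        a ⁻¹                 ≈⟨ identityˡ (a ⁻¹) ⟨
        ε ∙ a ⁻¹             ≈⟨ ∙-congʳ (conj-identity Γ s) ⟨
        conj Γ s ε ∙ a ⁻¹    ≈⟨ e 𝑁.ε ⟩
        ε                    ≈⟨ ε⁻¹≈ε ⟨
        ε ⁻¹                 ∎)

    nonabelian : ¬ (∀ {x y} → Mem N x → Mem N y → x ∙ y ≈ y ∙ x)
    nonabelian comm = let (x , x∈N , x≉ε) = nontrivial in
      x≉ε (centralizer-trivial x λ y∈N → commute⇒conj≈ Γ (comm x∈N y∈N))

    affine-inversion≉ε : ∀ x → ¬ (Affine.lift x 𝕊.∙ inversion 𝑁) 𝕊.≈ 𝕊.ε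
    -- By `anti`, the map `x ↦ s x⁻¹ s⁻¹` is the identity on `N`. It reverses products, so its
    -- values at `x ∙ y`, `x` and `y` show that `x` and `y` commute.
    affine-inversion≉ε ((a , _) , s) e = nonabelian λ {x} {y} x∈N y∈N → begin
        x ∙ y                              ≈⟨ anti (∙-closed N x∈N y∈N) ⟨
        conj Γ s ((x ∙ y) ⁻¹)              ≈⟨ conj-cong refl (⁻¹-anti-homo-∙ x y) ⟩
        conj Γ s (y ⁻¹ ∙ x ⁻¹)             ≈⟨ conj-∙ s (y ⁻¹) (x ⁻¹) ⟩
        conj Γ s (y ⁻¹) ∙ conj Γ s (x ⁻¹)  ≈⟨ ∙-cong (anti y∈N) (anti x∈N) ⟩
        y ∙ x                              ∎
      where
      a⁻¹≈ε : a ⁻¹ ≈ ε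
      a⁻¹≈ε = begin
        a ⁻¹                      ≈⟨ identityˡ (a ⁻¹) ⟨
        ε ∙ a ⁻¹                  ≈⟨ ∙-congʳ (trans (conj-cong refl ε⁻¹≈ε) (conj-identity Γ s)) ⟨
        conj Γ s (ε ⁻¹) ∙ a ⁻¹    ≈⟨ e 𝑁.ε ⟩
        ε                         ∎
      anti : ∀ {x} → Mem N x → conj Γ s (x ⁻¹) ≈ x
      anti {x} x∈N = begin
        conj Γ s (x ⁻¹)           ≈⟨ identityʳ _ ⟨
        conj Γ s (x ⁻¹) ∙ ε       ≈⟨ ∙-congˡ a⁻¹≈ε ⟨
        conj Γ s (x ⁻¹) ∙ a ⁻¹    ≈⟨ e (x , x∈N) ⟩
        x                         ∎

    affine-mono : Monomorphism AffineGroup 𝕊 Affine.lift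
    affine-mono = trivialKernel⇒monomorphism AffineGroup 𝕊 Affine.lift-homo
      (λ {x} → affine-kernel {x})

    full-mono : Monomorphism FullGroup 𝕊 Full.lift
    full-mono = trivialKernel⇒monomorphism FullGroup 𝕊 Full.lift-homo
      λ { {x , 0ℙ} e → affine-kernel {x} e , ≡.refl
        ; {x , 1ℙ} e → contradiction e (affine-inversion≉ε x) }

    -- Agreement on `N` means that `g` and `h` induce the same permutation of `N`. As `conjugation`
    -- is injective, `g ≈ h`, and the two automorphisms agree on all of `Γ`.
    inn-faithful : InnFaithfulOn Γ N
    inn-faithful φ ψ (g , d) (h , e) φ≈ψ x =
      trans (d x) (trans (conj-cong g≈h refl) (sym (e x)))
      where
      g≈h : g ≈ h
      g≈h = IsGroupMonomorphism.injective (Affine.inr-mono affine-mono)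
        λ (y , y∈N) → trans (sym (d y)) (trans (φ≈ψ y y∈N) (e y))

  -- Graph automorphisms from a connection set invariant under conjugation by `Γ`.

  module Connection (T : ConnectionSet 𝑁 q)
    (T-conj : ∀ s {x} → ConnectionSet.Mem T x →
              ConnectionSet.Mem T (Action.act (conjAction Γ N N-normal) s x))
    where
    private
      module T = ConnectionSet T
      Aut𝑁 : Subgroup 𝕊 _
      Aut𝑁 = Aut (Cay 𝑁 T)

    conjugation-preserves : ∀ s → Preserves 𝑁 T (Inverse.to (conjugation s))
    conjugation-preserves s {x} (t , t∈T , e) =
      _ , T-conj s t∈T , trans (conj-cong refl e) (conj-∙ s (proj₁ t) (proj₁ x))

    conjugation∈aut : ∀ s → Mem Aut𝑁 (conjugation s)
    conjugation∈aut s = preserves⇒aut 𝑁 T (conjugation s)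
      (λ {x} {y} → conjugation-preserves s {x} {y})
      (λ {x} {y} → conjugation-preserves (s ⁻¹) {x} {y})

    inversionPower∈aut : ∀ k → Mem Aut𝑁 (inversionPower k)
    inversionPower∈aut 0ℙ = ε-closed Aut𝑁
    -- Conjugation inside `N` and the action of `Γ` give the same element with different proofs of
    -- membership in `N`; `T.resp refl` passes between them.
    inversionPower∈aut 1ℙ = inversion∈aut 𝑁 T λ (g , _) {t} t∈T → T.resp refl (T-conj g {t} t∈T)

    affine∈aut : ∀ x → Mem Aut𝑁 (Affine.lift x)
    affine∈aut (a , s) = ∙-closed Aut𝑁 {translation a} {conjugation s}
      (rightRegular⊆aut 𝑁 T {translation a} (a 𝑁.⁻¹ , λ x → refl)) (conjugation∈aut s)

    full⊆aut : Mem (image FullGroup 𝕊 Full.lift-homo) ⊆ Mem Aut𝑁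
    full⊆aut {f} ((x , k) , e) =
      resp Aut𝑁 {Full.lift (x , k)} {f} (λ y → sym (e y))
        (∙-closed Aut𝑁 {Affine.lift x} {inversionPower k} (affine∈aut x) (inversionPower∈aut k))

-- Even permutations and 3-cycles.

module _ {n : ℕ} where
  private module S = Group (S n)

  -- Pigeonhole: if every point occurred in `xs`, sending it to its position would inject `Fin n`
  -- into `Fin (length xs)`.
  ∃-fresh : (xs : List (Fin n)) → length xs < n → ∃[ k ] k ∉ xs
  ∃-fresh xs xs<n = ¬∀⟶∃¬ n _ (_∈? xs) λ all →
    ≤⇒≯ (injective⇒≤ {f = λ k → index (all k)}
      (λ {k} {l} → Membership.index-injective (≡.setoid (Fin n)) (all k) (all l))) xs<n
    where open DecMembership _≟_ using (_∈?_)

  transpose-matchˡ : ∀ (i j : Fin n) → PC.transpose i j i ≡ j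
  transpose-matchˡ i j rewrite dec-true (i ≟ i) ≡.refl = ≡.refl

  transpose-mismatch : ∀ {i j k : Fin n} → k ≢ i → k ≢ j → PC.transpose i j k ≡ k
  transpose-mismatch {i} {j} {k} k≢i k≢j
    rewrite dec-false (k ≟ i) k≢i | dec-false (k ≟ j) k≢j = ≡.refl

  -- The witness is the 3-cycle `j ↦ k ↦ l ↦ j` on points other than `i`. As `eval` applies the head
  -- of the list first, it is the swap of `j` and `k` followed by that of `j` and `l`.
  even-fixing-moving : n ≥ 4 → ∀ {i j : Fin n} → i ≢ j →
                       ∃[ σ ] (IsEven σ × σ ⟨$⟩ʳ i ≡ i × σ ⟨$⟩ʳ j ≢ j)
  even-fixing-moving n≥4 {i} {j} i≢j =
    let (k , k∉) = ∃-fresh (i ∷ j ∷ []) (<-≤-trans (s≤s (s≤s (s≤s z≤n))) n≥4)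
        -- `n ≥ 4` unfolds to `3 < n`, the room needed for a point outside three given ones.
        (l , l∉) = ∃-fresh (i ∷ j ∷ k ∷ []) n≥4
        k≢i = λ e → k∉ (here e)
        k≢j = λ e → k∉ (there (here e))
        l≢i = λ e → l∉ (here e)
        l≢k = λ e → l∉ (there (there (here e)))
        ts : TranspositionList n
        ts = (j , k) ∷ (j , l) ∷ []
    in eval ts
     , (ts , (λ e → k≢j (≡.sym e)) ∷ (λ e → l∉ (there (here (≡.sym e)))) ∷ []
           , divides 1 ≡.refl , λ _ → ≡.refl)
     , ≡.trans (≡.cong (PC.transpose j l) (transpose-mismatch i≢j (λ e → k≢i (≡.sym e))))
               (transpose-mismatch i≢j (λ e → l≢i (≡.sym e)))
     , λ fixed → k≢j (≡.trans (≡.sym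
         (≡.trans (≡.cong (PC.transpose j l) (transpose-matchˡ j k))
                  (transpose-mismatch k≢j (λ e → l≢k (≡.sym e))))) fixed)

  -- If `σ` moves `i`, take an even `τ` that fixes `i` and moves `σ i`. The conjugate of `τ` by `σ`
  -- fixes `σ i` because `τ` fixes `i`, so it differs from `τ`.
  alt-centralizer-trivial : n ≥ 4 → ∀ σ →
    (∀ {τ} → IsEven τ → conj (S n) σ τ S.≈ τ) → σ S.≈ S.ε
  alt-centralizer-trivial n≥4 σ central i = decidable-stable (σ ⟨$⟩ʳ i ≟ i) λ σi≢i →
    let (τ , even , τi≡i , τσi≢σi) = even-fixing-moving n≥4 (λ e → σi≢i (≡.sym e))
    in τσi≢σi (≡.trans (≡.sym (central {τ} even (σ ⟨$⟩ʳ i)))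
         (≡.cong (σ ⟨$⟩ʳ_) (≡.trans (≡.cong (τ ⟨$⟩ʳ_) (inverseˡ σ)) τi≡i)))

  alt-nontrivial : n ≥ 4 → ∃[ σ ] (IsEven σ × ¬ (σ S.≈ S.ε))
  alt-nontrivial n≥4 =
    let (i , _)  = ∃-fresh [] (<-≤-trans (s≤s z≤n) n≥4)
        (j , j∉) = ∃-fresh (i ∷ []) (<-≤-trans (s≤s (s≤s z≤n)) n≥4)
        (σ , even , _ , σj≢j) = even-fixing-moving n≥4 {i} {j} (λ e → j∉ (here (≡.sym e)))
    in σ , even , λ σ≈ε → σj≢j (σ≈ε j)

  -- Conjugation by `σ` relabels the points of the cycle by `σ`.
  threeCycle-conj : ∀ σ {τ : Permutation′ n} → IsThreeCycle τ → IsThreeCycle (conj (S n) σ τ)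
  threeCycle-conj σ {τ} t = record
    { p₁ = σ ⟨$⟩ʳ p₁ ; p₂ = σ ⟨$⟩ʳ p₂ ; p₃ = σ ⟨$⟩ʳ p₃
    ; p₁≢p₂ = λ e → p₁≢p₂ (σ-injective e)
    ; p₂≢p₃ = λ e → p₂≢p₃ (σ-injective e)
    ; p₁≢p₃ = λ e → p₁≢p₃ (σ-injective e)
    ; p₁↦p₂ = conj-image p₁↦p₂ ; p₂↦p₃ = conj-image p₂↦p₃ ; p₃↦p₁ = conj-image p₃↦p₁
    ; fixes = λ k k≢₁ k≢₂ k≢₃ → ≡.trans
        (≡.cong (σ ⟨$⟩ʳ_) (fixes (Inverse.from σ k) (k≢₁ ∘σ) (k≢₂ ∘σ) (k≢₃ ∘σ)))
        (inverseʳ σ)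
    }
    where
    open IsThreeCycle t
    σ-injective : ∀ {i j} → σ ⟨$⟩ʳ i ≡ σ ⟨$⟩ʳ j → i ≡ j
    σ-injective e = ≡.trans (≡.sym (inverseˡ σ)) (≡.trans (≡.cong (Inverse.from σ) e) (inverseˡ σ))
    conj-image : ∀ {i j} → τ ⟨$⟩ʳ i ≡ j → conj (S n) σ τ ⟨$⟩ʳ (σ ⟨$⟩ʳ i) ≡ σ ⟨$⟩ʳ j
    conj-image e = ≡.cong (σ ⟨$⟩ʳ_) (≡.trans (≡.cong (τ ⟨$⟩ʳ_) (inverseˡ σ)) e)
    _∘σ : ∀ {k i} → k ≢ σ ⟨$⟩ʳ i → Inverse.from σ k ≢ i
    (k≢ ∘σ) e = k≢ (≡.trans (≡.sym (inverseʳ σ)) (≡.cong (σ ⟨$⟩ʳ_) e))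

theorem2p2 :
  (n : ℕ) → n ≥ 4 →
  let 𝕊  = Sym (Group.setoid (A n))
      R  = RightRegular (A n)
      I  = InnOn (S n) (Alt n)
      Z  = ⟨_⟩ 𝕊 (inversion (A n))
      AS = A n ⋊[ conjAction (S n) (Alt n) (Alt-normal n) ] S n
  in InnFaithfulOn (S n) (Alt n)
   × (asGroup Z ≅ ℤ₂)
   × Σ (Subgroup 𝕊 0ℓ) (λ K → Σ (Subgroup 𝕊 0ℓ) (λ L →
       IsInternalSemidirect 𝕊 R I K
     × IsInternalSemidirect 𝕊 K Z L
     × (Mem L ⊆ Mem (Aut (CAG n)))
     × (asGroup L ≅ (AS ⋊[ inversionAction (S n) (Alt n) (Alt-normal n) ] ℤ₂))))
theorem2p2 n n≥4 =
    inn-faithful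
  , image≅domain ℤ₂ 𝕊 (Full.inr-mono full-mono) {⟨_⟩ 𝕊 (inversion (A n))} generated-isImage
  , K , L
  , Affine.isInternalSemidirect affine-mono {P = RightRegular (A n)} {InnOn (S n) (Alt n)} {K}
      rightRegular-isImage innOn-isImage (image-isImage AffineGroup 𝕊 Affine.lift-homo)
  , Full.isInternalSemidirect full-mono {P = K} {⟨_⟩ 𝕊 (inversion (A n))} {L}
      (image-isImage AffineGroup 𝕊 Affine.lift-homo) generated-isImage
      (image-isImage FullGroup 𝕊 Full.lift-homo)
  , (λ {f} → full⊆aut {f})
  , image≅domain FullGroup 𝕊 full-mono {L} (image-isImage FullGroup 𝕊 Full.lift-homo)
  where
  open NormalSubgroup (S n) (Alt n) (Alt-normal n)
  open TrivialCentralizer (alt-centralizer-trivial n≥4) (alt-nontrivial n≥4)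
  open Connection (threeCycles n) (λ s {τ} → threeCycle-conj s {proj₁ τ})
  -- `K` consists of the maps `x ↦ s x s⁻¹ a⁻¹`; `L` contains these and their composites with the
  -- inversion.
  K L : Subgroup 𝕊 0ℓ
  K = image AffineGroup 𝕊 Affine.lift-homo
  L = image FullGroup 𝕊 Full.lift-homo
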